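{- Let $G=(V,E,w)$ be a finite connected graph with $|V|=n\ge2$ and weights $w:E\to\mathbb{R}_{>0}$. For every connected binary hierarchy $T\in\mathcal T_{\mathrm{conn}}^{\mathrm{bin}}(G)$, $$\frac{\operatorname{cost}_D^-(T)}{F(T)}=\sum_{S\in\mathcal I(T)}\mu_T(S)\rho_T(S)=\mathbb E_{\mu_T}[\rho_T].$$ In particular, if $T_\star\in\mathcal T_{\mathrm{conn}}^{\mathrm{bin}}(G)$ is free optimal, i.e. $F(T_\star)=\operatorname{OPT}_{\mathrm{free}}(G,w)$, then $$\frac{\operatorname{OPT}_{\mathrm{card}}(G,w)}{\operatorname{OPT}_{\mathrm{free}}(G,w)}\le\mathbb E_{\mu_{T_\star}}[\rho_{T_\star}].$$
   Context: $d_G$ is the shortest-path metric of $(V,E)$ with every edge of length $1$ (weights are not lengths); $\operatorname{diam}_{d_G}(S)=\max_{a,b\in S}d_G(a,b)$. A rooted binary hierarchy $T$ on $V$ is a rooted tree whose leaves are the vertices of $V$ and whose internal nodes have exactly two children; each node is identified with the set of leaves below it (a cluster); $C_T(x,y)$ is the cluster of the lowest common ancestor of $x,y$. $\mathcal T_{\mathrm{conn}}^{\mathrm{bin}}(G)$ is the set of rooted binary hierarchies all of whose clusters induce connected subgraphs of $G$. $\mathcal I(T)$ is the family of internal (non-leaf) clusters. For $S\in\mathcal I(T)$ with children $S^0,S^1$: $b_T(S)$ is the total weight of edges with one endpoint in $S^0$ and the other in $S^1$; $\Delta_T(S)=\operatorname{diam}_{d_G}(S)$; $a_T(S)=\Delta_T(S)b_T(S)$;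 $\rho_T(S)=(|S|-1)/\Delta_T(S)$. $F(T)=\sum_{xy\in E}w_{xy}\operatorname{diam}_{d_G}(C_T(x,y))>0$, and $\mu_T(S)=a_T(S)/F(T)$, which is a probability measure on $\mathcal I(T)$. $\operatorname{cost}_D^-(T)=\sum_{xy\in E}w_{xy}(|C_T(x,y)|-1)$. $\operatorname{OPT}_{\mathrm{free}}(G,w)$ is the minimum of $\sum_{xy\in E}w_{xy}u(x,y)$ over all ultrametrics $u$ on $V$ (metrics with $u(x,y)\le\max\{u(x,z),u(z,y)\}$) with $u\ge d_G$ on all pairs. Put $h_H(x,x)=0$, $h_H(x,y)=|C_H(x,y)|-1$ for $x\ne y$; $\operatorname{OPT}_{\mathrm{card}}(G,w)$ is the minimum of $\sum_{xy\in E}w_{xy}h_H(x,y)$ over all rooted binary hierarchies $H$ on $V$ with $h_H\ge d_G$ on all pairs. -}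

module Defs where

open import Algebra.Apartness.Bundles using (HeytingField)
import Algebra.Apartness.Properties.HeytingCommutativeRing as HCR
open import Algebra.Bundles using (Ring)
import Algebra.Definitions.RawMonoid as Multiple
import Algebra.Properties.Ring as RingProperties
open import Data.Bool.Base using (if_then_else_)
open import Data.Fin as Fin using (Fin; zero; suc)
import Data.Fin.Properties as Finₚ
open import Data.Fin.Subset using (Subset; _∈_; _∪_; ⁅_⁆; ∣_∣)
open import Data.Fin.Subset.Properties using (_∈?_; x∈⁅x⁆; x∈p∪q⁺)
open import Data.List.Base using (List; []; _∷_; _++_; map; foldr; filter; allFin; cartesianProduct)
open import Data.List.Extrema.Nat using (max; v≤max⁺)
import Data.List.Membership.Propositional as List
open import Data.List.Membership.Propositional.Properties
  using (∈-filter⁺; ∈-filter⁻; ∈-cartesianProduct⁺; ∈-allFin; ∈-map⁺)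
open import Data.List.Relation.Binary.Permutation.Propositional using (_↭_; ↭-sym)
open import Data.List.Relation.Binary.Permutation.Propositional.Properties using (∈-resp-↭)
open import Data.List.Relation.Unary.All using (All)
open import Data.List.Relation.Unary.Any as Any using (here; there)
open import Data.Nat.Base as ℕ using (ℕ; zero; suc; _∸_; z≤n; s≤s; z<s)
import Data.Nat.Properties as ℕₚ
open import Data.Product.Base using (∃; _×_; _,_; proj₁; proj₂; uncurry)
open import Data.Sum.Base using (_⊎_; inj₁; inj₂)
open import Data.Tree.Binary as Tree using (Tree; leaf; node)
open import Data.Unit.Base using (⊤; tt)
open import Level using (0ℓ) renaming (suc to lsuc; _⊔_ to _⊔ℓ_)
open import Relation.Binary.Core using (Rel)
open import Relation.Binary.Definitions using (Symmetric; Irreflexive; Decidable; tri<; tri≈; tri>)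
open import Relation.Binary.Lattice.Definitions using (Supremum)
open import Relation.Binary.PropositionalEquality as ≡ using (_≡_; _≢_)
open import Relation.Binary.Structures using (IsStrictPartialOrder)
open import Relation.Nullary using (¬_; Dec; yes; no; does; contradiction; _×-dec_; _⊎-dec_)

-- A constructive ordered field.  The strict order is primitive, and no
-- decidability or trichotomy is assumed: the classical real numbers, the
-- usual constructive (Cauchy or Dedekind) real numbers and the rationals
-- are all instances.

record OrderedField c ℓ₁ ℓ₂ : Set (lsuc (c ⊔ℓ ℓ₁ ⊔ℓ ℓ₂)) where
  infix 4 _<_ _≤_
  infixl 6 _⊔_
  field
    heytingField : HeytingField c ℓ₁ ℓ₂

  open HeytingField heytingField public

  field
    _<_                  : Rel Carrier ℓ₂
    isStrictPartialOrder : IsStrictPartialOrder _≈_ _<_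
    #⇒<                  : ∀ {x y} → x # y → x < y ⊎ y < x
    <⇒#                  : ∀ {x y} → x < y → x # y
    +-monoˡ-<            : ∀ z {x y} → x < y → x + z < y + z
    *-pos                : ∀ {x y} → 0# < x → 0# < y → 0# < x * y

  _≤_ : Rel Carrier ℓ₂
  x ≤ y = ¬ (y < x)

  field
    _⊔_      : Carrier → Carrier → Carrier
    supremum : Supremum _≤_ _⊔_

  module <-SPO = IsStrictPartialOrder isStrictPartialOrder

  ring : Ring c ℓ₁
  ring = record { isRing = isRing }

  fromℕ : ℕ → Carrier
  fromℕ k = Multiple._×_ (Ring.+-rawMonoid ring) k 1#

  -- #⇒invertible, applied to x # 0#, inverts x - 0# rather than x; the two
  -- are equal up to _≈_.
  infixl 7 _/_⟨_⟩
  _/_⟨_⟩ : ∀ x y → 0# < y → Carrier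
  x / y ⟨ 0<y ⟩ = x * proj₁ (#⇒invertible (#-sym (<⇒# 0<y)))

  ∑ : ∀ {a} {A : Set a} → List A → (A → Carrier) → Carrier
  ∑ xs f = foldr _+_ 0# (map f xs)

  infix 5 ∑
  syntax ∑ xs (λ x → e) = ∑[ x ∈ xs ] e

  𝔼 : ∀ {a} {A : Set a} → List A → (p f : A → Carrier) → Carrier
  𝔼 xs p f = ∑[ x ∈ xs ] p x * f x

  IsMinimum : ∀ {a p} {A : Set a} (P : A → Set p) (f : A → Carrier) →
              Carrier → Set _
  IsMinimum P f m = (∃ λ a → P a × f a ≈ m) × (∀ a → P a → m ≤ f a)

  <-cotrans : ∀ {x y} z → x < y → x < z ⊎ z < y
  <-cotrans z x<y with #-cotrans (<⇒# x<y) z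
  ... | inj₁ x#z with #⇒< x#z
  ...   | inj₁ x<z = inj₁ x<z
  ...   | inj₂ z<x = inj₂ (<-SPO.trans z<x x<y)
  <-cotrans z x<y | inj₂ z#y with #⇒< z#y
  ...   | inj₁ z<y = inj₂ z<y
  ...   | inj₂ y<z = inj₁ (<-SPO.trans x<y y<z)

  <-≤-trans : ∀ {x y z} → x < y → y ≤ z → x < z
  <-≤-trans {z = z} x<y y≤z with <-cotrans z x<y
  ... | inj₁ x<z = x<z
  ... | inj₂ z<y = contradiction z<y y≤z

  +-pos : ∀ {x y} → 0# < x → 0# < y → 0# < x + y
  +-pos {x} {y} 0<x 0<y = <-SPO.trans 0<y (<-SPO.<-respˡ-≈ (+-identityˡ y) (+-monoˡ-< y 0<x))

  open HCR heytingCommutativeRing using (1#0)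
  open RingProperties ring using (-‿distribˡ-*; -‿involutive)

  0<1 : 0# < 1#
  0<1 with #⇒< 1#0
  ... | inj₂ 0<1 = 0<1
  ... | inj₁ 1<0 = <-SPO.<-respʳ-≈ -1*-1≈1 (*-pos 0<-1 0<-1)
    where
    0<-1 : 0# < - 1#
    0<-1 = <-SPO.<-respˡ-≈ (-‿inverseʳ 1#) (<-SPO.<-respʳ-≈ (+-identityˡ (- 1#)) (+-monoˡ-< (- 1#) 1<0))
    -1*-1≈1 : - 1# * - 1# ≈ 1#
    -1*-1≈1 = trans (sym (-‿distribˡ-* 1# (- 1#))) (trans (-‿cong (*-identityˡ (- 1#))) (-‿involutive 1#))

  fromℕ-pos : ∀ {k} → 0 ℕ.< k → 0# < fromℕ k
  fromℕ-pos {suc zero}    _ = <-SPO.<-respʳ-≈ (sym (+-identityʳ 1#)) 0<1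
  fromℕ-pos {suc (suc k)} _ = +-pos 0<1 (fromℕ-pos {suc k} z<s)

  -- Division by a natural number, with the usual convention x /ℕ 0 = 0.
  infixl 7 _/ℕ_
  _/ℕ_ : Carrier → ℕ → Carrier
  x /ℕ zero    = 0#
  x /ℕ (suc k) = x / fromℕ (suc k) ⟨ fromℕ-pos {suc k} z<s ⟩

  ∑-pos : ∀ {a} {A : Set a} (xs : List A) (f : A → Carrier) →
          (∃ λ x → x List.∈ xs) → (∀ {x} → x List.∈ xs → 0# < f x) → 0# < ∑ xs f
  ∑-pos []           f (_ , ()) _
  ∑-pos (x ∷ [])     f _ pos = <-SPO.<-respʳ-≈ (sym (+-identityʳ (f x))) (pos (here ≡.refl))
  ∑-pos (x ∷ y ∷ ys) f _ pos =
    +-pos (pos (here ≡.refl)) (∑-pos (y ∷ ys) f (y , here ≡.refl) (λ z∈ → pos (there z∈)))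

infixr 5 _∷_

data Walk {a} {V : Set a} (R : Rel V 0ℓ) : ℕ → Rel V a where
  []  : ∀ {x} → Walk R 0 x x
  _∷_ : ∀ {k x y z} → R x y → Walk R k y z → Walk R (suc k) x z

walk? : ∀ {n} {R : Rel (Fin n) 0ℓ} → Decidable R → ∀ k → Decidable (Walk R k)
walk? R? zero x y with x Fin.≟ y
... | yes ≡.refl = yes []
... | no  x≢y    = no λ { [] → x≢y ≡.refl }
walk? R? (suc k) x y with Finₚ.any? (λ z → R? x z ×-dec walk? R? k z y)
... | yes (z , r , p) = yes (r ∷ p)
... | no  ∄z          = no λ { (r ∷ p) → ∄z (_ , r , p) }

IsLeast : ∀ {p} → (ℕ → Set p) → ℕ → Set p
IsLeast P m = P m × (∀ {j} → P j → m ℕ.≤ j)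

least : ∀ {p} {P : ℕ → Set p} → (∀ k → Dec (P k)) → ∃ P → ∃ (IsLeast P)
least {p} P? (k , pk) = search P? k pk
  where
  search : ∀ {P : ℕ → Set p} → (∀ k → Dec (P k)) → ∀ k → P k → ∃ (IsLeast P)
  search P? k pk with P? 0
  ... | yes p0 = 0 , p0 , λ _ → z≤n
  search P? zero    pk | no ¬p0 = contradiction pk ¬p0
  search P? (suc k) pk | no ¬p0 with search (λ i → P? (suc i)) k pk
  ... | m , pm , m≤ = suc m , pm , λ { {zero} p0 → contradiction p0 ¬p0 ; {suc j} pj → s≤s (m≤ pj) }

cluster : ∀ {n} → Tree ⊤ (Fin n) → Subset n
cluster (leaf v)     = ⁅ v ⁆
cluster (node l _ r) = cluster l ∪ cluster r

clusters : ∀ {n} → Tree ⊤ (Fin n) → List (Subset n)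
clusters t@(leaf _)     = cluster t ∷ []
clusters t@(node l _ r) = cluster t ∷ clusters l ++ clusters r

-- An internal cluster, presented by its two children.
record Internal (n : ℕ) : Set where
  constructor _⟨∪⟩_
  field
    S⁰ S¹ : Subset n

  S : Subset n
  S = S⁰ ∪ S¹

internals : ∀ {n} → Tree ⊤ (Fin n) → List (Internal n)
internals (leaf _)     = []
internals (node l _ r) = (cluster l ⟨∪⟩ cluster r) ∷ internals l ++ internals r

-- The cluster of the lowest common ancestor of x and y, provided both are
-- leaves of the tree.
lca : ∀ {n} → Tree ⊤ (Fin n) → Fin n → Fin n → Subset n
lca (leaf v)       x y = ⁅ v ⁆
lca t@(node l _ r) x y =
  if does (x ∈? cluster l ×-dec y ∈? cluster l) then lca l x y else
  if does (x ∈? cluster r ×-dec y ∈? cluster r) then lca r x y else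
  cluster t

-- Each vertex labels exactly one leaf.  The two children of a node are
-- ordered, which none of the quantities below depends on.
record Hierarchy (n : ℕ) : Set where
  field
    tree     : Tree ⊤ (Fin n)
    leaves-↭ : Tree.Leaves.toList tree ↭ allFin n

  C : Fin n → Fin n → Subset n
  C = lca tree

  𝓘 : List (Internal n)
  𝓘 = internals tree

  h : Fin n → Fin n → ℕ
  h x y = if does (x Fin.≟ y) then 0 else ∣ C x y ∣ ∸ 1

leaves⇒cluster : ∀ {n} (t : Tree ⊤ (Fin n)) {xs v} →
                 v List.∈ Tree.Leaves.toDiffList t xs → v ∈ cluster t ⊎ v List.∈ xs
leaves⇒cluster (leaf v) (here ≡.refl) = inj₁ (x∈⁅x⁆ v)
leaves⇒cluster (leaf v) (there v∈)    = inj₂ v∈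
leaves⇒cluster (node l _ r) v∈ with leaves⇒cluster l v∈
... | inj₁ v∈l = inj₁ (x∈p∪q⁺ (inj₁ v∈l))
... | inj₂ v∈′ with leaves⇒cluster r v∈′
...   | inj₁ v∈r = inj₁ (x∈p∪q⁺ (inj₂ v∈r))
...   | inj₂ v∈xs = inj₂ v∈xs

∈-root : ∀ {n} (T : Hierarchy n) v → v ∈ cluster (Hierarchy.tree T)
∈-root T v with leaves⇒cluster (Hierarchy.tree T) {[]} (∈-resp-↭ (↭-sym (Hierarchy.leaves-↭ T)) (∈-allFin v))
... | inj₁ v∈ = v∈

if-elim : ∀ {a p q} {A : Set a} {Q : Set q} (P : A → Set p) {t e} (Q? : Dec Q) →
          (Q → P t) → P e → P (if does Q? then t else e)
if-elim P (yes q) pt pe = pt q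
if-elim P (no _)  pt pe = pe

∈-lca : ∀ {n} (t : Tree ⊤ (Fin n)) {x y} → x ∈ cluster t → y ∈ cluster t →
        x ∈ lca t x y × y ∈ lca t x y
∈-lca (leaf v) x∈ y∈ = x∈ , y∈
∈-lca (node l _ r) {x} {y} x∈ y∈ =
  if-elim P (x ∈? cluster l ×-dec y ∈? cluster l) (uncurry (∈-lca l))
    (if-elim P (x ∈? cluster r ×-dec y ∈? cluster r) (uncurry (∈-lca r)) (x∈ , y∈))
  where
  P : Subset _ → Set
  P S = x ∈ S × y ∈ S

record WeightedGraph {c ℓ₁ ℓ₂} (K : OrderedField c ℓ₁ ℓ₂) (n : ℕ) : Set (lsuc 0ℓ ⊔ℓ c ⊔ℓ ℓ₁ ⊔ℓ ℓ₂) where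
  open OrderedField K
  infix 4 _~_ _~?_
  field
    _~_       : Rel (Fin n) 0ℓ
    _~?_      : Decidable _~_
    ~-sym     : Symmetric _~_
    ~-irrefl  : Irreflexive _≡_ _~_
    connected : ∀ x y → ∃ λ k → Walk _~_ k x y
    -- Only the values on edges matter.
    w         : Fin n → Fin n → Carrier
    w-sym     : ∀ {x y} → x ~ y → w x y ≈ w y x
    w-pos     : ∀ {x y} → x ~ y → 0# < w x y

module Clustering {c ℓ₁ ℓ₂} (K : OrderedField c ℓ₁ ℓ₂) {n : ℕ} (G : WeightedGraph K n) (2≤n : 2 ℕ.≤ n) where
  open OrderedField K public
  open WeightedGraph G public
  open Hierarchy public

  -- Every edge is listed once, as the pair (x , y) with x < y.
  edges : List (Fin n × Fin n)
  edges = filter (λ (x , y) → (x Fin.<? y) ×-dec (x ~? y)) (cartesianProduct (allFin n) (allFin n))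

  private
    shortest : ∀ x y → ∃ (IsLeast λ k → Walk _~_ k x y)
    shortest x y = least (λ k → walk? _~?_ k x y) (connected x y)

  d : Fin n → Fin n → ℕ
  d x y = proj₁ (shortest x y)

  d-isLeast : ∀ x y → IsLeast (λ k → Walk _~_ k x y) (d x y)
  d-isLeast x y = proj₂ (shortest x y)

  elements : Subset n → List (Fin n)
  elements S = filter (_∈? S) (allFin n)

  -- The base value 0 of the maximum matters only for the empty set.
  diam : Subset n → ℕ
  diam S = max 0 (map (uncurry d) (cartesianProduct (elements S) (elements S)))

  Induced : Subset n → Rel (Fin n) 0ℓ
  Induced S x y = x ∈ S × y ∈ S × x ~ y

  InducesConnected : Subset n → Set
  InducesConnected S = ∀ {x y} → x ∈ S → y ∈ S → ∃ λ k → Walk (Induced S) k x y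

  IsConnected : Hierarchy n → Set
  IsConnected T = All InducesConnected (clusters (tree T))

  cost : (Fin n → Fin n → Carrier) → Carrier
  cost u = ∑[ (x , y) ∈ edges ] w x y * u x y

  F : Hierarchy n → Carrier
  F T = cost λ x y → fromℕ (diam (C T x y))

  cost-D⁻ : Hierarchy n → Carrier
  cost-D⁻ T = cost λ x y → fromℕ (∣ C T x y ∣ ∸ 1)

  Crosses : Internal n → Fin n × Fin n → Set
  Crosses (S⁰ ⟨∪⟩ S¹) (x , y) = (x ∈ S⁰ × y ∈ S¹) ⊎ (x ∈ S¹ × y ∈ S⁰)

  crosses? : ∀ N e → Dec (Crosses N e)
  crosses? (S⁰ ⟨∪⟩ S¹) (x , y) = (x ∈? S⁰ ×-dec y ∈? S¹) ⊎-dec (x ∈? S¹ ×-dec y ∈? S⁰)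

  module _ (N : Internal n) where
    open Internal N

    b : Carrier
    b = ∑[ (x , y) ∈ filter (crosses? N) edges ] w x y

    Δ : ℕ
    Δ = diam S

    a : Carrier
    a = fromℕ Δ * b

    -- Δ is nonzero on the internal clusters of a hierarchy, since these
    -- have at least two elements.
    ρ : Carrier
    ρ = fromℕ (∣ S ∣ ∸ 1) /ℕ Δ

  record IsUltrametric (u : Fin n → Fin n → Carrier) : Set (c ⊔ℓ ℓ₁ ⊔ℓ ℓ₂) where
    field
      nonneg        : ∀ x y → 0# ≤ u x y
      u-refl        : ∀ x → u x x ≈ 0#
      u≈0⇒≡         : ∀ {x y} → u x y ≈ 0# → x ≡ y
      u-sym         : ∀ x y → u x y ≈ u y x
      triangle      : ∀ x y z → u x y ≤ u x z + u z y
      ultratriangle : ∀ x y z → u x y ≤ u x z ⊔ u z y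

  IsOPT-free : Carrier → Set _
  IsOPT-free = IsMinimum (λ u → IsUltrametric u × (∀ x y → fromℕ (d x y) ≤ u x y)) cost

  IsOPT-card : Carrier → Set _
  IsOPT-card = IsMinimum (λ H → ∀ x y → d x y ℕ.≤ h H x y) (λ H → cost λ x y → fromℕ (h H x y))

  ∈-edges⁻ : ∀ {x y} → (x , y) List.∈ edges → x ~ y
  ∈-edges⁻ e∈ = proj₂ (proj₂ (∈-filter⁻ (λ (x , y) → (x Fin.<? y) ×-dec (x ~? y)) {xs = cartesianProduct (allFin n) (allFin n)} e∈))

  ∈-edges⁺ : ∀ {x y} → x Fin.< y → x ~ y → (x , y) List.∈ edges
  ∈-edges⁺ x<y x~y = ∈-filter⁺ (λ (x , y) → (x Fin.<? y) ×-dec (x ~? y))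
    (∈-cartesianProduct⁺ (∈-allFin _) (∈-allFin _)) (x<y , x~y)

  edges-nonempty : ∃ λ e → e List.∈ edges
  edges-nonempty with connected (Fin.fromℕ< {0} (ℕₚ.<-trans z<s 2≤n)) (Fin.fromℕ< {1} 2≤n)
  ... | k , p = from-walk k p (λ eq → contradiction (≡.trans (≡.sym (Finₚ.toℕ-fromℕ< _)) (≡.trans (≡.cong Fin.toℕ eq) (Finₚ.toℕ-fromℕ< _))) λ ())
    where
    from-walk : ∀ {x y} k → Walk _~_ k x y → x ≢ y → ∃ λ e → e List.∈ edges
    from-walk _ []                         x≢y = contradiction ≡.refl x≢y
    from-walk _ (_∷_ {x = x} {y = z} r _) _ with Finₚ.<-cmp x z
    ... | tri< x<z _ _ = _ , ∈-edges⁺ x<z r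
    ... | tri≈ _ x≡z _ = contradiction r (~-irrefl x≡z)
    ... | tri> _ _ z<x = _ , ∈-edges⁺ z<x (~-sym r)

  d-pos : ∀ {x y} → x ~ y → 0 ℕ.< d x y
  d-pos {x} {y} x~y with d x y | d-isLeast x y
  ... | zero  | [] , _ = contradiction x~y (~-irrefl ≡.refl)
  ... | suc _ | _      = z<s

  d≤diam : ∀ {S x y} → x ∈ S → y ∈ S → d x y ℕ.≤ diam S
  d≤diam {S} x∈ y∈ = v≤max⁺ 0 _ (inj₂ (Any.map ℕₚ.≤-reflexive
    (∈-map⁺ (uncurry d) (∈-cartesianProduct⁺ (∈-elements x∈) (∈-elements y∈)))))
    where
    ∈-elements : ∀ {z} → z ∈ S → z List.∈ elements S
    ∈-elements = ∈-filter⁺ (_∈? S) (∈-allFin _)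

  F-pos : ∀ T → 0# < F T
  F-pos T = ∑-pos edges _ edges-nonempty λ {(x , y)} e∈ →
    let x~y     = ∈-edges⁻ e∈
        x∈ , y∈ = ∈-lca (tree T) (∈-root T x) (∈-root T y)
    in *-pos (w-pos x~y) (fromℕ-pos (ℕₚ.<-≤-trans (d-pos x~y) (d≤diam x∈ y∈)))

  OPT-free-pos : ∀ {m} → IsOPT-free m → 0# < m
  OPT-free-pos ((u , (_ , d≤u) , cost≈m) , _) = <-SPO.<-respʳ-≈ cost≈m
    (∑-pos edges _ edges-nonempty λ {(x , y)} e∈ →
      let x~y = ∈-edges⁻ e∈
      in *-pos (w-pos x~y) (<-≤-trans (fromℕ-pos (d-pos x~y)) (d≤u x y)))

  μ : Hierarchy n → Internal n → Carrier
  μ T N = a N / F T ⟨ F-pos T ⟩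

{-# OPTIONS --safe #-}
module Submission where

-- Both parts rest on one identity: E * F T ≈ cost-D⁻ T, where E is the
-- μ T-weighted sum of ρ over the internal clusters.
--
-- The factor F T cancels against the normalization of μ, and Δ S > 0 cancels
-- against the denominator of ρ, so E * F T is the sum over the internal
-- clusters S of b S * (∣ S ∣ - 1) (μρF≈b*size).  Exchanging the two sums, an
-- edge xy contributes w x y * (∣ S ∣ - 1) once for every internal cluster S
-- whose children it crosses.  The leaves being distinct, the children of a
-- node are disjoint, hence xy crosses exactly one node, namely the lowest
-- common ancestor of x and y (∑-crossed≈lca); what is left is cost-D⁻ T.
--
-- For the second part, the tree T⋆ itself is admissible for OPT-card
-- (d≤h): in a connected induced subgraph on S any two vertices are joined
-- by a walk without repeated vertices (Path), which has at most ∣ S ∣ - 1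
-- edges.  Hence OPT-card is at most the cost of h T⋆, which is cost-D⁻ T⋆,
-- and division by F T⋆ ≈ OPT-free gives the bound.

open import Defs
open import Algebra.Apartness.Bundles using (HeytingCommutativeRing)
open import Algebra.Bundles using (CommutativeRing)
import Algebra.Apartness.Properties.HeytingCommutativeRing as HeytingProperties
import Algebra.Properties.CommutativeSemigroup as CommutativeSemigroupProperties
open import Data.Bool.Base using (Bool; true; false; if_then_else_)
open import Data.Fin as Fin using (Fin)
open import Data.Fin.Subset using (Subset; _∈_; _∉_; _∪_; ⁅_⁆; ∣_∣) renaming (_-_ to _∖_)
open import Data.Fin.Subset.Properties
  using (_∈?_; x∈⁅x⁆; x∈⁅y⁆⇒x≡y; x∈p∪q⁺; x∈p∪q⁻; x∈p∧x≢y⇒x∈p-y; x∈p⇒∣p-x∣<∣p∣; p─x─y≡p─y─x; p─q⊆p)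
open import Data.List.Base using (List; []; _∷_; _++_; filter)
import Data.List.Membership.Propositional as List
open import Data.List.Membership.Propositional.Properties using (∈-++⁺ˡ; ∈-++⁺ʳ; ∈-++⁻)
open import Data.List.Relation.Binary.Permutation.Propositional using (↭-sym; ↭⇒↭ₛ)
open import Data.List.Relation.Binary.Permutation.Setoid.Properties using (Unique-resp-↭)
open import Data.List.Relation.Unary.All as All using ()
open import Data.List.Relation.Unary.Any using (here; there)
open import Data.List.Relation.Unary.Unique.Propositional using (Unique; _∷_)
open import Data.List.Relation.Unary.Unique.Propositional.Properties using (allFin⁺; Unique[x∷xs]⇒x∉xs)
open import Data.Nat.Base as ℕ using (ℕ; zero; suc; _∸_; z≤n; z<s)
import Data.Nat.Properties as ℕₚ
open import Data.Product.Base using (∃; ∃₂; _×_; _,_; proj₁; proj₂)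
open import Data.Sum.Base using (_⊎_; inj₁; inj₂)
open import Data.Tree.Binary as Tree using (Tree; leaf; node)
open import Data.Unit.Base using (⊤)
open import Level using (0ℓ)
open import Relation.Binary.Core using (Rel)
open import Relation.Binary.PropositionalEquality as ≡ using (_≡_; _≢_)
import Relation.Binary.Reasoning.Setoid as ≈-Reasoning
open import Relation.Nullary using (Dec; yes; no; ¬_; does; contradiction; _×-dec_)
open import Relation.Nullary.Decidable using (dec-true; dec-false)

if-yes : ∀ {a q} {A : Set a} {Q : Set q} (Q? : Dec Q) {t e : A} → Q → (if does Q? then t else e) ≡ t
if-yes Q? q = ≡.cong (if_then _ else _) (dec-true Q? q)

if-no : ∀ {a q} {A : Set a} {Q : Set q} (Q? : Dec Q) {t e : A} → ¬ Q → (if does Q? then t else e) ≡ e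
if-no Q? ¬q = ≡.cong (if_then _ else _) (dec-false Q? ¬q)

-- Ordered fields: quotients and finite sums

module OrderedFieldProperties {c ℓ₁ ℓ₂} (K : OrderedField c ℓ₁ ℓ₂) where
  open OrderedField K
  open HeytingProperties heytingCommutativeRing using (x-0≈x)
  open CommutativeRing (HeytingCommutativeRing.commutativeRing heytingCommutativeRing)
    using (+-commutativeSemigroup; *-commutativeSemigroup)
  open CommutativeSemigroupProperties +-commutativeSemigroup public using ()
    renaming (interchange to +-interchange)
  open CommutativeSemigroupProperties *-commutativeSemigroup public using ()
    renaming (xy∙z≈xz∙y to *-xy∙z≈xz∙y; xy∙z≈y∙zx to *-xy∙z≈y∙zx)
  open ≈-Reasoning setoid

  [x/y]*y≈x : ∀ x {y} (0<y : 0# < y) → (x / y ⟨ 0<y ⟩) * y ≈ x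
  [x/y]*y≈x x {y} 0<y = begin
    x * y⁻¹ * y          ≈⟨ *-assoc x y⁻¹ y ⟩
    x * (y⁻¹ * y)        ≈⟨ *-congˡ (*-congˡ (x-0≈x y)) ⟨
    x * (y⁻¹ * (y - 0#)) ≈⟨ *-congˡ (proj₁ (proj₂ y-inv)) ⟩
    x * 1#               ≈⟨ *-identityʳ x ⟩
    x                    ∎
    where
    y-inv = #⇒invertible (#-sym (<⇒# 0<y))
    y⁻¹   = proj₁ y-inv

  z*y≈x⇒x/y≈z : ∀ {x y z} (0<y : 0# < y) → z * y ≈ x → (x / y ⟨ 0<y ⟩) ≈ z
  z*y≈x⇒x/y≈z {x} {y} {z} 0<y z*y≈x = begin
    x * y⁻¹              ≈⟨ *-congʳ z*y≈x ⟨
    z * y * y⁻¹          ≈⟨ *-xy∙z≈xz∙y z y y⁻¹ ⟩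
    (z / y ⟨ 0<y ⟩) * y  ≈⟨ [x/y]*y≈x z 0<y ⟩
    z                    ∎
    where
    y⁻¹ = proj₁ (#⇒invertible (#-sym (<⇒# 0<y)))

  [x/ℕk]*k≈x : ∀ x {k} → 0 ℕ.< k → (x /ℕ k) * fromℕ k ≈ x
  [x/ℕk]*k≈x x {suc k} _ = [x/y]*y≈x x (fromℕ-pos {suc k} z<s)

  *-monoˡ-< : ∀ {x y z} → 0# < z → x < y → x * z < y * z
  *-monoˡ-< {x} {y} {z} 0<z x<y =
    <-SPO.<-respˡ-≈ (+-identityˡ (x * z))
      (<-SPO.<-respʳ-≈ cancel (+-monoˡ-< (x * z) (*-pos 0<y-x 0<z)))
    where
    0<y-x : 0# < y - x
    0<y-x = <-SPO.<-respˡ-≈ (-‿inverseʳ x) (+-monoˡ-< (- x) x<y)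
    cancel : (y - x) * z + x * z ≈ y * z
    cancel = begin
      (y - x) * z + x * z  ≈⟨ distribʳ z (y - x) x ⟨
      (y - x + x) * z      ≈⟨ *-congʳ (+-assoc y (- x) x) ⟩
      (y + (- x + x)) * z  ≈⟨ *-congʳ (+-congˡ (-‿inverseˡ x)) ⟩
      (y + 0#) * z         ≈⟨ *-congʳ (+-identityʳ y) ⟩
      y * z                ∎

  x≤z*y⇒x/y≤z : ∀ {x y z} (0<y : 0# < y) → x ≤ z * y → (x / y ⟨ 0<y ⟩) ≤ z
  x≤z*y⇒x/y≤z {x} 0<y x≤z*y z<x/y =
    x≤z*y (<-SPO.<-respʳ-≈ ([x/y]*y≈x x 0<y) (*-monoˡ-< 0<y z<x/y))

  if-distribʳ-* : ∀ (p : Bool) x y → (if p then x else 0#) * y ≈ (if p then x * y else 0#)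
  if-distribʳ-* true  x y = refl
  if-distribʳ-* false x y = zeroˡ y

  module _ {a} {A : Set a} where

    ∑-cong : ∀ (xs : List A) {f g : A → Carrier} →
             (∀ {x} → x List.∈ xs → f x ≈ g x) → ∑ xs f ≈ ∑ xs g
    ∑-cong []       f≈g = refl
    ∑-cong (x ∷ xs) f≈g = +-cong (f≈g (here ≡.refl)) (∑-cong xs λ x∈ → f≈g (there x∈))

    ∑-0 : ∀ (xs : List A) → ∑ xs (λ _ → 0#) ≈ 0#
    ∑-0 []       = refl
    ∑-0 (x ∷ xs) = trans (+-identityˡ _) (∑-0 xs)

    ∑-+ : ∀ (xs : List A) (f g : A → Carrier) → ∑ xs (λ x → f x + g x) ≈ ∑ xs f + ∑ xs g
    ∑-+ []       f g = sym (+-identityˡ 0#)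
    ∑-+ (x ∷ xs) f g = trans (+-congˡ (∑-+ xs f g)) (+-interchange (f x) (g x) _ _)

    ∑-distribʳ-* : ∀ (xs : List A) (f : A → Carrier) k → ∑ xs f * k ≈ ∑ xs (λ x → f x * k)
    ∑-distribʳ-* []       f k = zeroˡ k
    ∑-distribʳ-* (x ∷ xs) f k = trans (distribʳ k (f x) _) (+-congˡ (∑-distribʳ-* xs f k))

    ∑-++ : ∀ (xs ys : List A) (f : A → Carrier) → ∑ (xs ++ ys) f ≈ ∑ xs f + ∑ ys f
    ∑-++ []       ys f = sym (+-identityˡ _)
    ∑-++ (x ∷ xs) ys f = trans (+-congˡ (∑-++ xs ys f)) (sym (+-assoc (f x) _ _))

    ∑-filter : ∀ {p} {P : A → Set p} (P? : ∀ x → Dec (P x)) (xs : List A) (f : A → Carrier) →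
               ∑ (filter P? xs) f ≈ ∑ xs (λ x → if does (P? x) then f x else 0#)
    ∑-filter P? []       f = refl
    ∑-filter P? (x ∷ xs) f with P? x
    ... | yes _ = +-congˡ (∑-filter P? xs f)
    ... | no  _ = trans (∑-filter P? xs f) (sym (+-identityˡ _))

  ∑-swap : ∀ {a b} {A : Set a} {B : Set b} (xs : List A) (ys : List B) (f : A → B → Carrier) →
           ∑ xs (λ x → ∑ ys (f x)) ≈ ∑ ys (λ y → ∑ xs λ x → f x y)
  ∑-swap []       ys f = sym (∑-0 ys)
  ∑-swap (x ∷ xs) ys f = trans (+-congˡ (∑-swap xs ys f)) (sym (∑-+ ys (f x) _))

-- Loop erasure

module _ {n : ℕ} (R : Rel (Fin n) 0ℓ) where

  -- Path S k x y: a walk of length k from x to y that visits distinct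
  -- vertices of S only; a vertex is removed from S once it has been visited.
  data Path : Subset n → ℕ → Fin n → Fin n → Set where
    stop : ∀ {S x} → x ∈ S → Path S 0 x x
    step : ∀ {S k x y z} → x ∈ S → R x z → Path (S ∖ x) k z y → Path S (suc k) x y

module _ {n : ℕ} {R : Rel (Fin n) 0ℓ} where

  path-length : ∀ {S k x y} → Path R S k x y → k ℕ.< ∣ S ∣
  path-length (stop x∈S)     = ℕₚ.≤-<-trans z≤n (x∈p⇒∣p-x∣<∣p∣ x∈S)
  path-length (step x∈S _ p) = ℕₚ.≤-<-trans (path-length p) (x∈p⇒∣p-x∣<∣p∣ x∈S)

  path⇒walk : ∀ {S k x y} → Path R S k x y → Walk R k x y
  path⇒walk (stop _)     = []
  path⇒walk (step _ r p) = r ∷ path⇒walk p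

  -- The equation, rather than S ∖ v as an index, keeps the recursion
  -- structural: S ∖ v ∖ x and S ∖ x ∖ v are equal only propositionally.
  weaken : ∀ {S S′ k x y} v → S′ ≡ S ∖ v → Path R S′ k x y → Path R S k x y
  weaken {S} v ≡.refl (stop x∈) = stop (p─q⊆p S ⁅ v ⁆ x∈)
  weaken {S} {x = x} v ≡.refl (step x∈ r p) =
    step (p─q⊆p S ⁅ v ⁆ x∈) r (weaken v (p─x─y≡p─y─x S v x) p)

  -- A path either passes through v, and then its part after v is a path
  -- starting at v, or avoids v altogether.
  through-or-avoid : ∀ {S k x y} v → Path R S k x y →
                     (∃ λ j → Path R S j v y) ⊎ Path R (S ∖ v) k x y
  through-or-avoid {x = x} v p with x Fin.≟ v
  through-or-avoid v p | yes ≡.refl = inj₁ (_ , p)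
  through-or-avoid v (stop x∈) | no x≢v = inj₂ (stop (x∈p∧x≢y⇒x∈p-y x∈ x≢v))
  through-or-avoid {S} {x = x} v (step x∈ r p) | no x≢v with through-or-avoid v p
  ... | inj₁ (j , q) = inj₁ (j , weaken x ≡.refl q)
  ... | inj₂ q       = inj₂ (step (x∈p∧x≢y⇒x∈p-y x∈ x≢v) r
                               (≡.subst (λ S′ → Path R S′ _ _ _) (p─x─y≡p─y─x S x v) q))

  prepend : ∀ {S k x y z} → x ∈ S → R x z → Path R S k z y → ∃ λ j → Path R S j x y
  prepend {x = x} x∈ r p with through-or-avoid x p
  ... | inj₁ q = q
  ... | inj₂ q = _ , step x∈ r q

  walk⇒path : ∀ {S k x y} → x ∈ S → Walk (λ u v → u ∈ S × v ∈ S × R u v) k x y →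
              ∃ λ j → Path R S j x y
  walk⇒path x∈ []                   = 0 , stop x∈
  walk⇒path x∈ ((_ , z∈ , r) ∷ walk) = prepend x∈ r (proj₂ (walk⇒path z∈ walk))

-- Trees with distinct leaves

module _ {n : ℕ} where

  cluster-nonempty : ∀ (t : Tree ⊤ (Fin n)) → ∃ λ v → v ∈ cluster t
  cluster-nonempty (leaf v)     = v , x∈⁅x⁆ v
  cluster-nonempty (node l _ r) with cluster-nonempty l
  ... | v , v∈l = v , x∈p∪q⁺ (inj₁ v∈l)

  lca∈clusters : ∀ (t : Tree ⊤ (Fin n)) x y → lca t x y List.∈ clusters t
  lca∈clusters (leaf v)     x y = here ≡.refl
  lca∈clusters (node l _ r) x y =
    if-elim (List._∈ _) (x ∈? cluster l ×-dec y ∈? cluster l)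
      (λ _ → there (∈-++⁺ˡ (lca∈clusters l x y)))
      (if-elim (List._∈ _) (x ∈? cluster r ×-dec y ∈? cluster r)
        (λ _ → there (∈-++⁺ʳ (clusters l) (lca∈clusters r x y)))
        (here ≡.refl))

  -- The two children of every internal node have disjoint clusters.
  data Separated : Tree ⊤ (Fin n) → Set where
    leaf : ∀ v → Separated (leaf v)
    node : ∀ {l m r} → (∀ {v} → v ∈ cluster l → v ∉ cluster r) →
           Separated l → Separated r → Separated (node l m r)

  -- Leaves.toDiffList t xs is the list of the leaves of t followed by xs.

  ∈-leaves-rest : ∀ (t : Tree ⊤ (Fin n)) {xs v} → v List.∈ xs → v List.∈ Tree.Leaves.toDiffList t xs
  ∈-leaves-rest (leaf _)     v∈ = there v∈
  ∈-leaves-rest (node l _ r) v∈ = ∈-leaves-rest l (∈-leaves-rest r v∈)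

  cluster⇒leaves : ∀ (t : Tree ⊤ (Fin n)) {xs v} → v ∈ cluster t → v List.∈ Tree.Leaves.toDiffList t xs
  cluster⇒leaves (leaf u)     v∈ = here (x∈⁅y⁆⇒x≡y u v∈)
  cluster⇒leaves (node l _ r) v∈ with x∈p∪q⁻ (cluster l) (cluster r) v∈
  ... | inj₁ v∈l = cluster⇒leaves l v∈l
  ... | inj₂ v∈r = ∈-leaves-rest l (cluster⇒leaves r v∈r)

  -- The conclusions about xs make the induction go through: at a node, xs
  -- contains the leaves of the right child when the left one is treated.
  unique⇒separated : ∀ (t : Tree ⊤ (Fin n)) {xs} → Unique (Tree.Leaves.toDiffList t xs) →
                     Separated t × Unique xs × (∀ {v} → v ∈ cluster t → ¬ v List.∈ xs)
  unique⇒separated (leaf u) uniq@(_ ∷ uniq-xs) =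
    leaf u , uniq-xs , λ v∈u v∈xs →
      Unique[x∷xs]⇒x∉xs uniq (≡.subst (List._∈ _) (x∈⁅y⁆⇒x≡y u v∈u) v∈xs)
  unique⇒separated (node l _ r) uniq with unique⇒separated l uniq
  ... | sep-l , uniq-r , l# with unique⇒separated r uniq-r
  ...   | sep-r , uniq-xs , r# =
    node (λ v∈l v∈r → l# v∈l (cluster⇒leaves r v∈r)) sep-l sep-r , uniq-xs , disjoint
    where
    disjoint : ∀ {v} → v ∈ cluster l ∪ cluster r → ¬ v List.∈ _
    disjoint v∈ v∈xs with x∈p∪q⁻ (cluster l) (cluster r) v∈
    ... | inj₁ v∈l = l# v∈l (∈-leaves-rest r v∈xs)
    ... | inj₂ v∈r = r# v∈r v∈xs

  hierarchy-separated : ∀ (T : Hierarchy n) → Separated (Hierarchy.tree T)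
  hierarchy-separated T = proj₁ (unique⇒separated (Hierarchy.tree T) {[]}
    (Unique-resp-↭ (≡.setoid (Fin n)) (↭⇒↭ₛ (↭-sym (Hierarchy.leaves-↭ T))) (allFin⁺ n)))

  -- An internal cluster has two distinct elements, hence positive diameter.
  internal-distinct : ∀ {t : Tree ⊤ (Fin n)} → Separated t → ∀ {N} → N List.∈ internals t →
                      ∃₂ λ x y → x ≢ y × x ∈ Internal.S N × y ∈ Internal.S N
  internal-distinct (node {l} {_} {r} l# _ _) (here ≡.refl)
    with cluster-nonempty l | cluster-nonempty r
  ... | x , x∈l | y , y∈r =
    x , y , (λ { ≡.refl → l# x∈l y∈r }) , x∈p∪q⁺ (inj₁ x∈l) , x∈p∪q⁺ (inj₂ y∈r)
  internal-distinct (node {l} _ sep-l sep-r) (there N∈) with ∈-++⁻ (internals l) N∈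
  ... | inj₁ N∈l = internal-distinct sep-l N∈l
  ... | inj₂ N∈r = internal-distinct sep-r N∈r

module ClusteringProperties {c ℓ₁ ℓ₂} (K : OrderedField c ℓ₁ ℓ₂) {n : ℕ}
                            (G : WeightedGraph K n) (2≤n : 2 ℕ.≤ n) where
  open Clustering K G 2≤n
  open OrderedFieldProperties K
  open ≈-Reasoning setoid

  -- Every edge crosses exactly one internal node

  crosses⇒∈ : ∀ N {x y} → Crosses N (x , y) → x ∈ Internal.S N × y ∈ Internal.S N
  crosses⇒∈ N (inj₁ (x∈ , y∈)) = x∈p∪q⁺ (inj₁ x∈) , x∈p∪q⁺ (inj₂ y∈)
  crosses⇒∈ N (inj₂ (x∈ , y∈)) = x∈p∪q⁺ (inj₂ x∈) , x∈p∪q⁺ (inj₁ y∈)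

  module _ (f : Subset n → Carrier) (x y : Fin n) where

    -- f (S N) if the pair (x , y) crosses N, and 0 otherwise.
    crossed : Internal n → Carrier
    crossed N = if does (crosses? N (x , y)) then f (Internal.S N) else 0#

    ∑-crossed≈0 : ∀ t → ¬ (x ∈ cluster t × y ∈ cluster t) → ∑ (internals t) crossed ≈ 0#
    ∑-crossed≈0 (leaf _)     _  = refl
    ∑-crossed≈0 (node l _ r) ∉t = begin
      crossed N + ∑ (internals l ++ internals r) crossed
        ≈⟨ +-cong (reflexive (if-no (crosses? N (x , y)) λ cr → ∉t (crosses⇒∈ N cr)))
                  (∑-++ (internals l) (internals r) crossed) ⟩
      0# + (∑ (internals l) crossed + ∑ (internals r) crossed)
        ≈⟨ +-identityˡ _ ⟩
      ∑ (internals l) crossed + ∑ (internals r) crossed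
        ≈⟨ +-cong (∑-crossed≈0 l λ (x∈ , y∈) → ∉t (x∈p∪q⁺ (inj₁ x∈) , x∈p∪q⁺ (inj₁ y∈)))
                  (∑-crossed≈0 r λ (x∈ , y∈) → ∉t (x∈p∪q⁺ (inj₂ x∈) , x∈p∪q⁺ (inj₂ y∈))) ⟩
      0# + 0#
        ≈⟨ +-identityˡ 0# ⟩
      0# ∎
      where
      N = cluster l ⟨∪⟩ cluster r

    -- Only the lowest common ancestor is crossed: below it the pair lies in
    -- at most one child, and above it both endpoints lie in the same child.
    ∑-crossed≈lca : x ≢ y → ∀ {t} → Separated t → x ∈ cluster t → y ∈ cluster t →
                    ∑ (internals t) crossed ≈ f (lca t x y)
    ∑-crossed≈lca x≢y (leaf v) x∈ y∈ =
      contradiction (≡.trans (x∈⁅y⁆⇒x≡y v x∈) (≡.sym (x∈⁅y⁆⇒x≡y v y∈))) x≢y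
    ∑-crossed≈lca x≢y (node {l} {m} {r} l# sep-l sep-r) x∈ y∈ =
      trans (+-congˡ (∑-++ (internals l) (internals r) crossed)) split
      where
      N  = cluster l ⟨∪⟩ cluster r
      Σl = ∑ (internals l) crossed
      Σr = ∑ (internals r) crossed
      S  = lca (node l m r) x y

      both-l? = x ∈? cluster l ×-dec y ∈? cluster l
      both-r? = x ∈? cluster r ×-dec y ∈? cluster r

      crosses⇒¬both-l : Crosses N (x , y) → ¬ (x ∈ cluster l × y ∈ cluster l)
      crosses⇒¬both-l (inj₁ (_ , y∈r)) (_ , y∈l) = l# y∈l y∈r
      crosses⇒¬both-l (inj₂ (x∈r , _)) (x∈l , _) = l# x∈l x∈r

      crosses⇒¬both-r : Crosses N (x , y) → ¬ (x ∈ cluster r × y ∈ cluster r)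
      crosses⇒¬both-r (inj₁ (x∈l , _)) (x∈r , _) = l# x∈l x∈r
      crosses⇒¬both-r (inj₂ (_ , y∈l)) (_ , y∈r) = l# y∈l y∈r

      crosses-only-root : Crosses N (x , y) → crossed N + (Σl + Σr) ≈ f S
      crosses-only-root cr = begin
        crossed N + (Σl + Σr)
          ≈⟨ +-cong (reflexive (if-yes (crosses? N (x , y)) cr))
                    (+-cong (∑-crossed≈0 l ¬both-l) (∑-crossed≈0 r ¬both-r)) ⟩
        f (cluster (node l m r)) + (0# + 0#)
          ≈⟨ trans (+-congˡ (+-identityˡ 0#)) (+-identityʳ _) ⟩
        f (cluster (node l m r))
          ≡⟨ ≡.cong f (≡.trans (if-no both-l? ¬both-l) (if-no both-r? ¬both-r)) ⟨
        f S ∎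
        where
        ¬both-l = crosses⇒¬both-l cr
        ¬both-r = crosses⇒¬both-r cr

      split : crossed N + (Σl + Σr) ≈ f S
      split with x∈p∪q⁻ (cluster l) (cluster r) x∈ | x∈p∪q⁻ (cluster l) (cluster r) y∈
      ... | inj₁ x∈l | inj₂ y∈r = crosses-only-root (inj₁ (x∈l , y∈r))
      ... | inj₂ x∈r | inj₁ y∈l = crosses-only-root (inj₂ (x∈r , y∈l))
      ... | inj₁ x∈l | inj₁ y∈l = begin
        crossed N + (Σl + Σr)
          ≈⟨ +-cong (reflexive (if-no (crosses? N (x , y)) λ cr → crosses⇒¬both-l cr (x∈l , y∈l)))
                    (+-cong (∑-crossed≈lca x≢y sep-l x∈l y∈l) (∑-crossed≈0 r λ (x∈r , _) → l# x∈l x∈r)) ⟩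
        0# + (f (lca l x y) + 0#)
          ≈⟨ trans (+-identityˡ _) (+-identityʳ _) ⟩
        f (lca l x y)
          ≡⟨ ≡.cong f (if-yes both-l? (x∈l , y∈l)) ⟨
        f S ∎
      ... | inj₂ x∈r | inj₂ y∈r = begin
        crossed N + (Σl + Σr)
          ≈⟨ +-cong (reflexive (if-no (crosses? N (x , y)) λ cr → crosses⇒¬both-r cr (x∈r , y∈r)))
                    (+-cong (∑-crossed≈0 l λ (x∈l , _) → l# x∈l x∈r) (∑-crossed≈lca x≢y sep-r x∈r y∈r)) ⟩
        0# + (0# + f (lca r x y))
          ≈⟨ trans (+-identityˡ _) (+-identityˡ _) ⟩
        f (lca r x y)
          ≡⟨ ≡.cong f (≡.trans (if-no both-l? λ (x∈l , _) → l# x∈l x∈r) (if-yes both-r? (x∈r , y∈r))) ⟨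
        f S ∎

  edge⇒≢ : ∀ {x y} → (x , y) List.∈ edges → x ≢ y
  edge⇒≢ e∈ x≡y = ~-irrefl x≡y (∈-edges⁻ e∈)

  -- The cost of any function of the lowest common ancestor's cluster, grouped
  -- by that ancestor: the edges whose ancestor is N have total weight b N.
  ∑-b≈cost : ∀ T (g : Subset n → Carrier) →
             ∑ (𝓘 T) (λ N → b N * g (Internal.S N)) ≈ cost (λ x y → g (C T x y))
  ∑-b≈cost T g = begin
    ∑ (𝓘 T) (λ N → b N * g (Internal.S N))
      ≈⟨ ∑-cong (𝓘 T) (λ {N} _ → expand N) ⟩
    ∑ (𝓘 T) (λ N → ∑ edges λ (x , y) → crossed (λ S → w x y * g S) x y N)
      ≈⟨ ∑-swap (𝓘 T) edges _ ⟩
    ∑ edges (λ (x , y) → ∑ (𝓘 T) (crossed (λ S → w x y * g S) x y))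
      ≈⟨ ∑-cong edges (λ {(x , y)} e∈ → ∑-crossed≈lca (λ S → w x y * g S) x y (edge⇒≢ e∈)
                        (hierarchy-separated T) (∈-root T x) (∈-root T y)) ⟩
    cost (λ x y → g (C T x y)) ∎
    where
    expand : ∀ N → b N * g (Internal.S N) ≈
                   ∑ edges (λ (x , y) → crossed (λ S → w x y * g S) x y N)
    expand N = begin
      b N * g (Internal.S N)
        ≈⟨ *-congʳ (∑-filter (crosses? N) edges _) ⟩
      ∑ edges (λ e@(x , y) → if does (crosses? N e) then w x y else 0#) * g (Internal.S N)
        ≈⟨ ∑-distribʳ-* edges _ _ ⟩
      ∑ edges (λ e@(x , y) → (if does (crosses? N e) then w x y else 0#) * g (Internal.S N))
        ≈⟨ ∑-cong edges (λ {e} _ → if-distribʳ-* (does (crosses? N e)) _ _) ⟩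
      ∑ edges (λ (x , y) → crossed (λ S → w x y * g S) x y N) ∎

  -- The expectation of ρ

  d-pos-≢ : ∀ {x y} → x ≢ y → 0 ℕ.< d x y
  d-pos-≢ {x} {y} x≢y with d x y | d-isLeast x y
  ... | zero  | [] , _ = contradiction ≡.refl x≢y
  ... | suc _ | _      = z<s

  Δ-pos : ∀ T {N} → N List.∈ 𝓘 T → 0 ℕ.< Δ N
  Δ-pos T N∈ with internal-distinct (hierarchy-separated T) N∈
  ... | x , y , x≢y , x∈ , y∈ = ℕₚ.<-≤-trans (d-pos-≢ x≢y) (d≤diam x∈ y∈)

  μρF≈b*size : ∀ T {N} → N List.∈ 𝓘 T → μ T N * ρ N * F T ≈ b N * fromℕ (∣ Internal.S N ∣ ∸ 1)
  μρF≈b*size T {N} N∈ = begin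
    μ T N * ρ N * F T           ≈⟨ *-xy∙z≈xz∙y (μ T N) (ρ N) (F T) ⟩
    μ T N * F T * ρ N           ≈⟨ *-congʳ ([x/y]*y≈x (a N) (F-pos T)) ⟩
    fromℕ (Δ N) * b N * ρ N     ≈⟨ *-xy∙z≈y∙zx (fromℕ (Δ N)) (b N) (ρ N) ⟩
    b N * (ρ N * fromℕ (Δ N))   ≈⟨ *-congˡ ([x/ℕk]*k≈x _ (Δ-pos T N∈)) ⟩
    b N * fromℕ (∣ Internal.S N ∣ ∸ 1) ∎

  𝔼ρ*F≈cost-D⁻ : ∀ T → 𝔼 (𝓘 T) (μ T) ρ * F T ≈ cost-D⁻ T
  𝔼ρ*F≈cost-D⁻ T = begin
    𝔼 (𝓘 T) (μ T) ρ * F T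
      ≈⟨ ∑-distribʳ-* (𝓘 T) _ (F T) ⟩
    ∑ (𝓘 T) (λ N → μ T N * ρ N * F T)
      ≈⟨ ∑-cong (𝓘 T) (μρF≈b*size T) ⟩
    ∑ (𝓘 T) (λ N → b N * fromℕ (∣ Internal.S N ∣ ∸ 1))
      ≈⟨ ∑-b≈cost T (λ S → fromℕ (∣ S ∣ ∸ 1)) ⟩
    cost-D⁻ T ∎

  -- The cardinality ultrametric of a connected hierarchy

  d≤∣S∣-1 : ∀ {S x y} → InducesConnected S → x ∈ S → y ∈ S → d x y ℕ.≤ ∣ S ∣ ∸ 1
  d≤∣S∣-1 {x = x} {y} conn x∈ y∈ with walk⇒path x∈ (proj₂ (conn x∈ y∈))
  ... | _ , p = ℕₚ.≤-trans (proj₂ (d-isLeast x y) (path⇒walk p)) (ℕₚ.<⇒≤pred (path-length p))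

  d≤h : ∀ T → IsConnected T → ∀ x y → d x y ℕ.≤ h T x y
  d≤h T conn x y =
    if-elim (d x y ℕ.≤_) (x Fin.≟ y)
      (λ { ≡.refl → proj₂ (d-isLeast x x) [] })
      (let x∈ , y∈ = ∈-lca (tree T) (∈-root T x) (∈-root T y)
       in d≤∣S∣-1 (All.lookup conn (lca∈clusters (tree T) x y)) x∈ y∈)

  cost-h≈cost-D⁻ : ∀ T → cost (λ x y → fromℕ (h T x y)) ≈ cost-D⁻ T
  cost-h≈cost-D⁻ T = ∑-cong edges λ {(x , y)} e∈ →
    *-congˡ (reflexive (≡.cong fromℕ (if-no (x Fin.≟ y) (edge⇒≢ e∈))))

  OPT-card≤cost-D⁻ : ∀ T → IsConnected T → ∀ {m} → IsOPT-card m → m ≤ cost-D⁻ T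
  OPT-card≤cost-D⁻ T conn (_ , m≤) cost-D⁻<m =
    m≤ T (d≤h T conn) (<-SPO.<-respˡ-≈ (sym (cost-h≈cost-D⁻ T)) cost-D⁻<m)

lemma17 : ∀ {c ℓ₁ ℓ₂} (K : OrderedField c ℓ₁ ℓ₂) {n : ℕ} (G : WeightedGraph K n) (2≤n : 2 ℕ.≤ n) →
    let open Clustering K G 2≤n in
    (∀ (T : Hierarchy n) → IsConnected T →
    ((cost-D⁻ T / F T ⟨ F-pos T ⟩) ≈ (∑[ S ∈ 𝓘 T ] μ T S * ρ S)) ×
    ((∑[ S ∈ 𝓘 T ] μ T S * ρ S) ≈ 𝔼 (𝓘 T) (μ T) ρ)) ×
    (∀ (T⋆ : Hierarchy n) → IsConnected T⋆ →
    ∀ {OPT-card OPT-free} → IsOPT-card OPT-card → (isOPT-free : IsOPT-free OPT-free) →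
    F T⋆ ≈ OPT-free →
    (OPT-card / OPT-free ⟨ OPT-free-pos isOPT-free ⟩) ≤ 𝔼 (𝓘 T⋆) (μ T⋆) ρ)
lemma17 K G 2≤n =
  (λ T _ → z*y≈x⇒x/y≈z (F-pos T) (𝔼ρ*F≈cost-D⁻ T) , refl) ,
  (λ T⋆ conn isOPT-card isOPT-free F≈OPT-free →
    x≤z*y⇒x/y≤z (OPT-free-pos isOPT-free) λ 𝔼ρ*OPT-free<OPT-card →
      OPT-card≤cost-D⁻ T⋆ conn isOPT-card
        (<-SPO.<-respˡ-≈ (trans (*-congˡ (sym F≈OPT-free)) (𝔼ρ*F≈cost-D⁻ T⋆)) 𝔼ρ*OPT-free<OPT-card))
  where
  open Clustering K G 2≤n
  open OrderedFieldProperties K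
  open ClusteringProperties K G 2≤n
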